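{- Let $(X,r)$ and $(Y,s)$ be non-degenerate and involutive set-theoretic solutions of the Yang-Baxter equation, with $|X|=n$ and $|Y|=m$. Let $c:V\otimes V\rightarrow V\otimes V$ and $d:V'\otimes V'\rightarrow V'\otimes V'$ be the linearisations of $r$ and $s$ respectively, and denote also by $c$ and $d$ their representing matrices with respect to the lexicographically ordered bases. Partition $c$ into $n^2$ square blocks $B_{ij}$ of order $n$ ($1\le i,j\le n$), and partition $d$ into $m^2$ square blocks $B'_{kl}$ of order $m$ ($1\le k,l\le m$). Let $c\boxtimes d$ denote the Tracy-Singh product of the matrices $c$ and $d$ with these partitions. Let $(Z,t)$, with $Z=X\times Y$, be the direct product of $(X,r)$ and $(Y,s)$, with linearisation $e:W\otimes W\rightarrow W\otimes W$. Then $c\boxtimes d$ is the representing matrix of the linear automorphism $e$ with respect to the (lexicographically ordered) basis $Z\otimes Z$ of $W\otimes W$.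
   Context: A set-theoretic solution of the Yang-Baxter equation (st-YBE) is a pair $(X,r)$ where $X$ is a non-empty set and $r:X\times X\to X\times X$, $r(x,y)=(\sigma_x(y),\gamma_y(x))$, is a bijective map satisfying $r^{12}r^{23}r^{12}=r^{23}r^{12}r^{23}$ on $X^3$, where $r^{12}=r\times \mathrm{Id}_X$ and $r^{23}=\mathrm{Id}_X\times r$. It is non-degenerate if $\sigma_x$ and $\gamma_x$ are bijections of $X$ for every $x\in X$, and involutive if $r^2=\mathrm{Id}_{X\times X}$. Write $X=\{x_1,\dots,x_n\}$, $Y=\{y_1,\dots,y_m\}$, $r(x_i,x_j)=(x_{\sigma_i(j)},x_{\gamma_j(i)})$ and $s(y_k,y_l)=(y_{\alpha_k(l)},y_{\beta_l(k)})$, so that $\sigma_i,\gamma_i$ are regarded as permutations of $\{1,\dots,n\}$ and $\alpha_k,\beta_k$ as permutations of $\{1,\dots,m\}$. Direct product: $Z=X\times Y$ and $t:Z^2\to Z^2$ is defined by $t((x_i,y_k),(x_j,y_l))=((x_{\sigma_i(j)},y_{\alpha_k(l)}),(x_{\gamma_j(i)},y_{\beta_l(k)}))$; $(Z,t)$ is again a non-degenerate involutive st-YBE. Linearisation: for $(X,r)$ with $X=\{x_1,\dots,x_n\}$, let $V$ be the real vector space with basis $\{e_1,\dots,e_n\}$ in bijection with $X$; the linearisation of $r$ is the linear operator $c:V\otimes V\to V\otimes V$ induced by $r$, i.e. $c(e_i\otimes e_j)=e_{\sigma_i(j)}\otimes e_{\gamma_j(i)}$. Similarly for $(Y,s)$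 (with space $V'$) and $(Z,t)$ (with space $W$ having basis in bijection with $Z$). Ordering and matrix conventions: the basis $\{e_i\otimes e_j\}$ of $V\otimes V$ is ordered lexicographically, and similarly for $V'\otimes V'$. The elements of $Z$ are ordered lexicographically, $(x_1,y_1),(x_1,y_2),\dots,(x_1,y_m),(x_2,y_1),\dots,(x_n,y_m)$, and the basis $Z\otimes Z$ of $W\otimes W$ consists of the tensors $z\otimes z'$, $z,z'\in Z$ (identified with the corresponding basis vectors of $W$), ordered lexicographically with respect to this order on $Z$. Columns of a representing matrix are the coordinates of the images of the basis vectors. Tracy-Singh product: for a matrix $A$ partitioned into blocks $A_{ij}$ and a matrix $B$ partitioned into blocks $B_{kl}$, $A\boxtimes B=((A_{ij}\otimes B_{kl})_{kl})_{ij}$, where $\otimes$ is the Kronecker product $A\otimes B=(a_{ij}B)_{ij}$; that is, $A\boxtimes B$ is the block matrix whose $(i,j)$ outer block is itself the block matrix whose $(k,l)$ block is $A_{ij}\otimes B_{kl}$. -}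

module Defs where

open import Algebra.Bundles using (CommutativeRing)
open import Algebra.Module.Bundles using (Module)
open import Algebra.Module.Morphism.Structures using (module ModuleMorphisms)
open import Algebra.Module.Structures.Biased using (IsModuleFromLeft)
import Algebra.Definitions as Definitions
import Algebra.Properties.CommutativeMonoid.Sum as CommutativeMonoidSum
open import Data.Fin.Base
  using (Fin; zero; suc; _↑ˡ_; _↑ʳ_; combine; remQuot; quotient; remainder)
open import Data.Fin.Properties using (*↔×; remQuot-combine; combine-remQuot)
open import Data.Nat.Base using (ℕ; zero; suc; _+_; _*_)
open import Data.Product.Base using (_×_; _,_; proj₁; proj₂)
open import Data.Product.Function.NonDependent.Propositional using (_×-↔_)
open import Data.Vec.Functional using (Vector)
open import Function.Base using (_∘_)
open import Function.Bundles using (_↔_; Inverse)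
open import Function.Construct.Composition using (_↔-∘_)
open import Function.Definitions using (Bijective)
open import Level using (Level; _⊔_) renaming (suc to lsuc)
open import Relation.Binary.PropositionalEquality.Core as ≡ using (_≡_; _≗_)
import Relation.Binary.Reasoning.Setoid as SetoidReasoning

private
  variable
    x y : Level

module _ {X : Set x} (r : X × X → X × X) where

  r¹² : X × X × X → X × X × X
  r¹² (u , v , w) = let (u′ , v′) = r (u , v) in u′ , v′ , w

  r²³ : X × X × X → X × X × X
  r²³ (u , v , w) = u , r (v , w)

record Solution x : Set (lsuc x) where
  field
    X        : Set x
    nonEmpty : X
    r        : X × X → X × X
    r-bij    : Bijective _≡_ _≡_ r
    braid    : r¹² r ∘ r²³ r ∘ r¹² r ≗ r²³ r ∘ r¹² r ∘ r²³ r

  -- r (u , v) = (σ u v , γ v u)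
  σ : X → X → X
  σ u v = proj₁ (r (u , v))

  γ : X → X → X
  γ v u = proj₂ (r (u , v))

NonDegenerate : Solution x → Set x
NonDegenerate S = ∀ u → Bijective _≡_ _≡_ (σ u) × Bijective _≡_ _≡_ (γ u)
  where open Solution S

Involutive : Solution x → Set x
Involutive S = Definitions.Involutive _≡_ r
  where open Solution S

directProduct : Solution x → Solution y → Solution (x ⊔ y)
directProduct S T = record
  { X        = S.X × T.X
  ; nonEmpty = S.nonEmpty , T.nonEmpty
  ; r        = t
  ; r-bij    = injective , surjective
  ; braid    = λ { ((u , a) , (v , b) , (w , c)) →
                   ≡.cong₂ zip₃ (S.braid (u , v , w)) (T.braid (a , b , c)) }
  }
  where
  module S = Solution S
  module T = Solution T

  t : (S.X × T.X) × (S.X × T.X) → (S.X × T.X) × (S.X × T.X)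
  t ((u , a) , (v , b)) = (S.σ u v , T.σ a b) , (S.γ v u , T.γ b a)

  zip₂ : S.X × S.X → T.X × T.X → (S.X × T.X) × (S.X × T.X)
  zip₂ (u , v) (a , b) = (u , a) , (v , b)

  zip₃ : S.X × S.X × S.X → T.X × T.X × T.X →
         (S.X × T.X) × (S.X × T.X) × (S.X × T.X)
  zip₃ (u , v , w) (a , b , c) = (u , a) , (v , b) , (w , c)

  unzip₁ : (S.X × T.X) × (S.X × T.X) → S.X × S.X
  unzip₁ ((u , _) , (v , _)) = u , v

  unzip₂ : (S.X × T.X) × (S.X × T.X) → T.X × T.X
  unzip₂ ((_ , a) , (_ , b)) = a , b

  injective : ∀ {p q} → t p ≡ t q → p ≡ q
  injective eq = ≡.cong₂ zip₂
    (proj₁ S.r-bij (≡.cong unzip₁ eq)) (proj₁ T.r-bij (≡.cong unzip₂ eq))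

  surjective : ∀ q → _
  surjective q with proj₂ S.r-bij (unzip₁ q) | proj₂ T.r-bij (unzip₂ q)
  ... | p₁ , h₁ | p₂ , h₂ =
    zip₂ p₁ p₂ , λ { ≡.refl → ≡.cong₂ zip₂ (h₁ ≡.refl) (h₂ ≡.refl) }

-- Lexicographic: `combine i k` ↦ (xᵢ , yₖ).
lexicographic : {X : Set x} {Y : Set y} {n m : ℕ} →
                Fin n ↔ X → Fin m ↔ Y → Fin (n * m) ↔ (X × Y)
lexicographic ξ υ = (ξ ×-↔ υ) ↔-∘ *↔×

-- In place of the real numbers, which the library lacks, R is an arbitrary
-- commutative ring.
module LinearAlgebra {a ℓ} (R : CommutativeRing a ℓ) where

  private
    module R = CommutativeRing R
    module ∑ᴿ = CommutativeMonoidSum R.+-commutativeMonoid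

    variable
      m₁ ℓ₁ m₂ ℓ₂ : Level
      k l n p q p′ q′ s t s′ t′ : ℕ

  Matrix : ℕ → ℕ → Set a
  Matrix p q = Fin p → Fin q → R.Carrier

  -- p × q blocks, all of them of size s × t
  BlockMatrix : (p q s t : ℕ) → Set a
  BlockMatrix p q s t = Fin p → Fin q → Matrix s t

  partition : ∀ p q → Matrix (p * s) (q * t) → BlockMatrix p q s t
  partition p q A i j u v = A (combine i u) (combine j v)

  flatten : BlockMatrix p q s t → Matrix (p * s) (q * t)
  flatten {p = p} {q} {s} {t} A i j =
    A (quotient {p} s i) (quotient {q} t j)
      (remainder {p} s i) (remainder {q} t j)

  infixl 7 _⊗ᴷ_ _⊠_

  -- Kronecker product
  _⊗ᴷ_ : Matrix p q → Matrix s t → Matrix (p * s) (q * t)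
  A ⊗ᴷ B = flatten λ i j u v → A i j R.* B u v

  -- Tracy-Singh product
  _⊠_ : BlockMatrix p q s t → BlockMatrix p′ q′ s′ t′ →
        BlockMatrix p q (p′ * (s * s′)) (q′ * (t * t′))
  (A ⊠ B) i j = flatten λ k l → A i j ⊗ᴷ B k l

  module _ (M : Module R m₁ ℓ₁) where
    open Module M
    open CommutativeMonoidSum +ᴹ-commutativeMonoid using (sum)

    linearCombination : Vector R.Carrier k → Vector Carrierᴹ k → Carrierᴹ
    linearCombination a v = sum λ i → a i *ₗ v i

    -- Every vector is a linear combination of the basis vectors with
    -- uniquely determined coefficients.
    record Basis (k : ℕ) : Set (a ⊔ ℓ ⊔ m₁ ⊔ ℓ₁) where
      field
        vector : Vector Carrierᴹ k
        coord  : Carrierᴹ → Vector R.Carrier k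
        expand : ∀ v → v ≈ᴹ linearCombination (coord v) vector
        unique : ∀ v a → v ≈ᴹ linearCombination a vector →
                 ∀ i → coord v i R.≈ a i

  -- The columns are the coordinates of the images of the basis vectors.
  representingMatrix : {M : Module R m₁ ℓ₁} → Basis M k →
                       (Module.Carrierᴹ M → Module.Carrierᴹ M) → Matrix k k
  representingMatrix b f i j = Basis.coord b (f (Basis.vector b j)) i

  module Sums (M : Module R m₁ ℓ₁) where
    open Module M
    open CommutativeMonoidSum +ᴹ-commutativeMonoid
    open SetoidReasoning ≈ᴹ-setoid

    sum-* : ∀ c (v : Vector Carrierᴹ k) →
            c *ₗ sum v ≈ᴹ sum (λ i → c *ₗ v i)
    sum-* {k = zero}  c v = *ₗ-zeroʳ c
    sum-* {k = suc k} c v =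
      ≈ᴹ-trans (*ₗ-distribˡ c _ _) (+ᴹ-congˡ (sum-* c (v ∘ suc)))

    sum-↑ : ∀ n (v : Vector Carrierᴹ (n + k)) →
            sum v ≈ᴹ sum (λ i → v (i ↑ˡ k)) +ᴹ sum (λ i → v (n ↑ʳ i))
    sum-↑ zero    v = ≈ᴹ-sym (+ᴹ-identityˡ _)
    sum-↑ (suc n) v =
      ≈ᴹ-trans (+ᴹ-congˡ (sum-↑ n (v ∘ suc))) (≈ᴹ-sym (+ᴹ-assoc _ _ _))

    sum-combine : ∀ n (v : Vector Carrierᴹ (n * k)) →
                  sum v ≈ᴹ sum λ i → sum λ j → v (combine {n} i j)
    sum-combine          zero    v = ≈ᴹ-refl
    sum-combine {k = k} (suc n) v =
      ≈ᴹ-trans (sum-↑ k v) (+ᴹ-congˡ (sum-combine n (v ∘ (k ↑ʳ_))))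

    module _ (e : Vector Carrierᴹ k) where
      lc-cong : ∀ {c d : Vector R.Carrier k} → (∀ i → c i R.≈ d i) →
                linearCombination M c e ≈ᴹ linearCombination M d e
      lc-cong eq = sum-cong-≋ λ i → *ₗ-congʳ (eq i)

      lc-+ : ∀ c d → linearCombination M c e +ᴹ linearCombination M d e ≈ᴹ
                     linearCombination M (λ i → c i R.+ d i) e
      lc-+ c d = begin
        linearCombination M c e +ᴹ linearCombination M d e
          ≈⟨ ∑-distrib-+ {k} (λ i → c i *ₗ e i) (λ i → d i *ₗ e i) ⟨
        sum (λ i → c i *ₗ e i +ᴹ d i *ₗ e i)
          ≈⟨ sum-cong-≋ (λ i → *ₗ-distribʳ (e i) (c i) (d i)) ⟨
        linearCombination M (λ i → c i R.+ d i) e ∎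

      lc-* : ∀ c d → c *ₗ linearCombination M d e ≈ᴹ
                     linearCombination M (λ i → c R.* d i) e
      lc-* c d = begin
        c *ₗ linearCombination M d e
          ≈⟨ sum-* {k} c (λ i → d i *ₗ e i) ⟩
        sum (λ i → c *ₗ (d i *ₗ e i))
          ≈⟨ sum-cong-≋ (λ i → *ₗ-assoc c (d i) (e i)) ⟨
        linearCombination M (λ i → c R.* d i) e ∎

      lc-0 : 0ᴹ ≈ᴹ linearCombination M (λ _ → R.0#) e
      lc-0 = begin
        0ᴹ                                ≈⟨ *ₗ-zeroˡ _ ⟨
        R.0# *ₗ sum e                     ≈⟨ sum-* R.0# e ⟩
        linearCombination M (λ _ → R.0#) e ∎

  module Coordinates {M : Module R m₁ ℓ₁} (b : Basis M k) where
    open Module M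
    open Basis b
    open Sums M
    open CommutativeMonoidSum +ᴹ-commutativeMonoid using (sum)

    coord-cong : ∀ {v w} → v ≈ᴹ w → ∀ i → coord v i R.≈ coord w i
    coord-cong {v} {w} eq = unique v _ (≈ᴹ-trans eq (expand w))

    coord-+ : ∀ v w i → coord (v +ᴹ w) i R.≈ coord v i R.+ coord w i
    coord-+ v w = unique _ _
      (≈ᴹ-trans (+ᴹ-cong (expand v) (expand w)) (lc-+ vector _ _))

    coord-* : ∀ c v i → coord (c *ₗ v) i R.≈ c R.* coord v i
    coord-* c v = unique _ _
      (≈ᴹ-trans (*ₗ-congˡ (expand v)) (lc-* vector c _))

    coord-0 : ∀ i → coord 0ᴹ i R.≈ R.0#
    coord-0 = unique _ _ (lc-0 vector)

    coord-lc : ∀ c i → coord (linearCombination M c vector) i R.≈ c i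
    coord-lc c = unique _ c ≈ᴹ-refl

    coord-sum : ∀ (v : Vector Carrierᴹ n) i →
                coord (sum v) i R.≈ ∑ᴿ.sum (λ j → coord (v j) i)
    coord-sum {n = zero}  v i = coord-0 i
    coord-sum {n = suc n} v i = R.trans (coord-+ _ _ i)
                                  (R.+-congˡ (coord-sum (v ∘ suc) i))

  -- Tensor products: formal expressions modulo the least congruence
  -- that makes them an R-module and _⊗ᵛ_ bilinear.
  module _ (M : Module R m₁ ℓ₁) (N : Module R m₂ ℓ₂) where
    private
      module M = Module M
      module N = Module N

    infixr 7 _*ᵗ_
    infixl 6 _+ᵗ_
    infix  8 _⊗ᵛ_
    infix  4 _≈ᵗ_

    data Tensor : Set (a ⊔ m₁ ⊔ m₂) where
      _⊗ᵛ_ : M.Carrierᴹ → N.Carrierᴹ → Tensor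
      0ᵗ   : Tensor
      _+ᵗ_ : Tensor → Tensor → Tensor
      _*ᵗ_ : R.Carrier → Tensor → Tensor

    data _≈ᵗ_ : Tensor → Tensor → Set (a ⊔ ℓ ⊔ m₁ ⊔ ℓ₁ ⊔ m₂ ⊔ ℓ₂) where
      reflᵗ  : ∀ {u} → u ≈ᵗ u
      symᵗ   : ∀ {u v} → u ≈ᵗ v → v ≈ᵗ u
      transᵗ : ∀ {u v w} → u ≈ᵗ v → v ≈ᵗ w → u ≈ᵗ w

      ⊗-cong       : ∀ {v v′ w w′} → v M.≈ᴹ v′ → w N.≈ᴹ w′ → v ⊗ᵛ w ≈ᵗ v′ ⊗ᵛ w′
      +ᵗ-cong      : ∀ {u u′ v v′} → u ≈ᵗ u′ → v ≈ᵗ v′ → u +ᵗ v ≈ᵗ u′ +ᵗ v′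
      *ᵗ-cong      : ∀ {c c′ u u′} → c R.≈ c′ → u ≈ᵗ u′ → c *ᵗ u ≈ᵗ c′ *ᵗ u′

      +ᵗ-assoc     : ∀ u v w → (u +ᵗ v) +ᵗ w ≈ᵗ u +ᵗ (v +ᵗ w)
      +ᵗ-comm      : ∀ u v → u +ᵗ v ≈ᵗ v +ᵗ u
      +ᵗ-identityˡ : ∀ u → 0ᵗ +ᵗ u ≈ᵗ u
      *ᵗ-zeroˡ     : ∀ u → R.0# *ᵗ u ≈ᵗ 0ᵗ
      *ᵗ-identityˡ : ∀ u → R.1# *ᵗ u ≈ᵗ u
      *ᵗ-assoc     : ∀ c d u → (c R.* d) *ᵗ u ≈ᵗ c *ᵗ (d *ᵗ u)
      *ᵗ-distribˡ  : ∀ c u v → c *ᵗ (u +ᵗ v) ≈ᵗ c *ᵗ u +ᵗ c *ᵗ v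
      *ᵗ-distribʳ  : ∀ u c d → (c R.+ d) *ᵗ u ≈ᵗ c *ᵗ u +ᵗ d *ᵗ u

      ⊗-+ˡ         : ∀ v v′ w → (v M.+ᴹ v′) ⊗ᵛ w ≈ᵗ v ⊗ᵛ w +ᵗ v′ ⊗ᵛ w
      ⊗-+ʳ         : ∀ v w w′ → v ⊗ᵛ (w N.+ᴹ w′) ≈ᵗ v ⊗ᵛ w +ᵗ v ⊗ᵛ w′
      ⊗-*ˡ         : ∀ c v w → (c M.*ₗ v) ⊗ᵛ w ≈ᵗ c *ᵗ v ⊗ᵛ w
      ⊗-*ʳ         : ∀ c v w → v ⊗ᵛ (c N.*ₗ w) ≈ᵗ c *ᵗ v ⊗ᵛ w

    private
      +ᵗ-identityʳ : ∀ u → u +ᵗ 0ᵗ ≈ᵗ u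
      +ᵗ-identityʳ u = transᵗ (+ᵗ-comm u 0ᵗ) (+ᵗ-identityˡ u)

      *ᵗ-zeroʳ : ∀ c → c *ᵗ 0ᵗ ≈ᵗ 0ᵗ
      *ᵗ-zeroʳ c = transᵗ (*ᵗ-cong R.refl (symᵗ (*ᵗ-zeroˡ 0ᵗ)))
        (transᵗ (symᵗ (*ᵗ-assoc c R.0# 0ᵗ))
        (transᵗ (*ᵗ-cong (R.zeroʳ c) reflᵗ) (*ᵗ-zeroˡ 0ᵗ)))

      -ᵗ_ : Tensor → Tensor
      -ᵗ u = (R.- R.1#) *ᵗ u

      inverseˡ : ∀ u → (-ᵗ u) +ᵗ u ≈ᵗ 0ᵗ
      inverseˡ u = transᵗ (+ᵗ-cong reflᵗ (symᵗ (*ᵗ-identityˡ u)))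
        (transᵗ (symᵗ (*ᵗ-distribʳ u (R.- R.1#) R.1#))
        (transᵗ (*ᵗ-cong (R.-‿inverseˡ R.1#) reflᵗ) (*ᵗ-zeroˡ u)))

    infixl 7 _⊗_

    _⊗_ : Module R (a ⊔ m₁ ⊔ m₂) (a ⊔ ℓ ⊔ m₁ ⊔ ℓ₁ ⊔ m₂ ⊔ ℓ₂)
    _⊗_ = record
      { Carrierᴹ = Tensor
      ; _≈ᴹ_     = _≈ᵗ_
      ; _+ᴹ_     = _+ᵗ_
      ; _*ₗ_     = _*ᵗ_
      ; _*ᵣ_     = λ u c → c *ᵗ u
      ; 0ᴹ       = 0ᵗ
      ; -ᴹ_      = -ᵗ_
      ; isModule = IsModuleFromLeft.isModule {commutativeRing = R} record
        { isLeftModule = record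
          { isLeftSemimodule = record
            { +ᴹ-isCommutativeMonoid = record
              { isMonoid = record
                { isSemigroup = record
                  { isMagma = record
                    { isEquivalence = record
                      { refl = reflᵗ ; sym = symᵗ ; trans = transᵗ }
                    ; ∙-cong = +ᵗ-cong
                    }
                  ; assoc = +ᵗ-assoc
                  }
                ; identity = +ᵗ-identityˡ , +ᵗ-identityʳ
                }
              ; comm = +ᵗ-comm
              }
            ; isPreleftSemimodule = record
              { *ₗ-cong      = *ᵗ-cong
              ; *ₗ-zeroˡ     = *ᵗ-zeroˡ
              ; *ₗ-distribʳ  = *ᵗ-distribʳ
              ; *ₗ-identityˡ = *ᵗ-identityˡ
              ; *ₗ-assoc     = *ᵗ-assoc
              ; *ₗ-zeroʳ     = *ᵗ-zeroʳ
              ; *ₗ-distribˡ  = *ᵗ-distribˡ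
              }
            }
          ; -ᴹ‿cong    = *ᵗ-cong R.refl
          ; -ᴹ‿inverse = inverseˡ ,
                         λ u → transᵗ (+ᵗ-comm u (-ᵗ u)) (inverseˡ u)
          }
        }
      }

  module _ {M : Module R m₁ ℓ₁} {N : Module R m₂ ℓ₂}
           (b : Basis M k) (b′ : Basis N l) where
    private
      module M = Module M
      module N = Module N
      module T = Module (M ⊗ N)
      module B = Basis b
      module B′ = Basis b′
      module C = Coordinates b
      module C′ = Coordinates b′
      module ∑ᴹ = CommutativeMonoidSum M.+ᴹ-commutativeMonoid
      module ∑ᴺ = CommutativeMonoidSum N.+ᴹ-commutativeMonoid
      module ∑ᵀ = CommutativeMonoidSum T.+ᴹ-commutativeMonoid
      module ST = Sums (M ⊗ N)

      coord₂ : Tensor M N → Fin k → Fin l → R.Carrier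
      coord₂ (v ⊗ᵛ w) i j = B.coord v i R.* B′.coord w j
      coord₂ 0ᵗ       i j = R.0#
      coord₂ (u +ᵗ v) i j = coord₂ u i j R.+ coord₂ v i j
      coord₂ (c *ᵗ u) i j = c R.* coord₂ u i j

      coord₂-cong : ∀ {u v} → u T.≈ᴹ v → ∀ i j → coord₂ u i j R.≈ coord₂ v i j
      coord₂-cong reflᵗ               i j = R.refl
      coord₂-cong (symᵗ e)            i j = R.sym (coord₂-cong e i j)
      coord₂-cong (transᵗ e f)        i j =
        R.trans (coord₂-cong e i j) (coord₂-cong f i j)
      coord₂-cong (⊗-cong e f)        i j =
        R.*-cong (C.coord-cong e i) (C′.coord-cong f j)
      coord₂-cong (+ᵗ-cong e f)       i j =
        R.+-cong (coord₂-cong e i j) (coord₂-cong f i j)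
      coord₂-cong (*ᵗ-cong e f)       i j = R.*-cong e (coord₂-cong f i j)
      coord₂-cong (+ᵗ-assoc u v w)    i j = R.+-assoc _ _ _
      coord₂-cong (+ᵗ-comm u v)       i j = R.+-comm _ _
      coord₂-cong (+ᵗ-identityˡ u)    i j = R.+-identityˡ _
      coord₂-cong (*ᵗ-zeroˡ u)        i j = R.zeroˡ _
      coord₂-cong (*ᵗ-identityˡ u)    i j = R.*-identityˡ _
      coord₂-cong (*ᵗ-assoc c d u)    i j = R.*-assoc _ _ _
      coord₂-cong (*ᵗ-distribˡ c u v) i j = R.distribˡ _ _ _
      coord₂-cong (*ᵗ-distribʳ u c d) i j = R.distribʳ _ _ _
      coord₂-cong (⊗-+ˡ v v′ w)       i j =
        R.trans (R.*-congʳ (C.coord-+ v v′ i)) (R.distribʳ _ _ _)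
      coord₂-cong (⊗-+ʳ v w w′)       i j =
        R.trans (R.*-congˡ (C′.coord-+ w w′ j)) (R.distribˡ _ _ _)
      coord₂-cong (⊗-*ˡ c v w)        i j =
        R.trans (R.*-congʳ (C.coord-* c v i)) (R.*-assoc _ _ _)
      coord₂-cong (⊗-*ʳ c v w)        i j = begin
        B.coord v i R.* B′.coord (c N.*ₗ w) j
          ≈⟨ R.*-congˡ (C′.coord-* c w j) ⟩
        B.coord v i R.* (c R.* B′.coord w j)  ≈⟨ R.*-assoc _ _ _ ⟨
        B.coord v i R.* c R.* B′.coord w j    ≈⟨ R.*-congʳ (R.*-comm _ _) ⟩
        c R.* B.coord v i R.* B′.coord w j    ≈⟨ R.*-assoc _ _ _ ⟩
        c R.* (B.coord v i R.* B′.coord w j)  ∎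
        where open SetoidReasoning R.setoid

      coord₂-sum : ∀ (v : Vector (Tensor M N) n) i j →
                   coord₂ (∑ᵀ.sum v) i j R.≈ ∑ᴿ.sum (λ h → coord₂ (v h) i j)
      coord₂-sum {n = zero}  v i j = R.refl
      coord₂-sum {n = suc n} v i j = R.+-congˡ (coord₂-sum (v ∘ suc) i j)

      ⊗-0ˡ : ∀ w → M.0ᴹ ⊗ᵛ w T.≈ᴹ 0ᵗ
      ⊗-0ˡ w = transᵗ (⊗-cong (M.≈ᴹ-sym (M.*ₗ-zeroˡ M.0ᴹ)) N.≈ᴹ-refl)
        (transᵗ (⊗-*ˡ R.0# M.0ᴹ w) (*ᵗ-zeroˡ _))

      ⊗-0ʳ : ∀ v → v ⊗ᵛ N.0ᴹ T.≈ᴹ 0ᵗ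
      ⊗-0ʳ v = transᵗ (⊗-cong M.≈ᴹ-refl (N.≈ᴹ-sym (N.*ₗ-zeroˡ N.0ᴹ)))
        (transᵗ (⊗-*ʳ R.0# v N.0ᴹ) (*ᵗ-zeroˡ _))

      ⊗-sumˡ : ∀ (v : Vector M.Carrierᴹ n) w →
               ∑ᴹ.sum v ⊗ᵛ w T.≈ᴹ ∑ᵀ.sum (λ i → v i ⊗ᵛ w)
      ⊗-sumˡ {n = zero}  v w = ⊗-0ˡ w
      ⊗-sumˡ {n = suc n} v w =
        transᵗ (⊗-+ˡ _ _ w) (+ᵗ-cong reflᵗ (⊗-sumˡ (v ∘ suc) w))

      ⊗-sumʳ : ∀ v (w : Vector N.Carrierᴹ n) →
               v ⊗ᵛ ∑ᴺ.sum w T.≈ᴹ ∑ᵀ.sum (λ i → v ⊗ᵛ w i)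
      ⊗-sumʳ {n = zero}  v w = ⊗-0ʳ v
      ⊗-sumʳ {n = suc n} v w =
        transᵗ (⊗-+ʳ v _ _) (+ᵗ-cong reflᵗ (⊗-sumʳ v (w ∘ suc)))

      pure : Fin k × Fin l → Tensor M N
      pure (i , j) = B.vector i ⊗ᵛ B′.vector j

      vectorᵗ : Vector (Tensor M N) (k * l)
      vectorᵗ h = pure (remQuot {k} l h)

      coordᵗ : Tensor M N → Vector R.Carrier (k * l)
      coordᵗ u h = coord₂ u (quotient {k} l h) (remainder {k} l h)

      lc₂ : ∀ c → linearCombination (M ⊗ N) c vectorᵗ T.≈ᴹ
                  ∑ᵀ.sum (λ i → ∑ᵀ.sum (λ j → c (combine i j) *ᵗ pure (i , j)))
      lc₂ c = transᵗ (ST.sum-combine k _)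
        (∑ᵀ.sum-cong-≋ λ i → ∑ᵀ.sum-cong-≋ λ j →
          T.≈ᴹ-reflexive
            (≡.cong (λ z → c (combine i j) *ᵗ pure z) (remQuot-combine i j)))

      expand-⊗ : ∀ v w → v ⊗ᵛ w T.≈ᴹ
                 linearCombination (M ⊗ N) (coordᵗ (v ⊗ᵛ w)) vectorᵗ
      expand-⊗ v w = begin
        v ⊗ᵛ w
          ≈⟨ ⊗-cong (B.expand v) (B′.expand w) ⟩
        ∑ᴹ.sum (λ i → α i M.*ₗ B.vector i) ⊗ᵛ ∑ᴺ.sum (λ j → β j N.*ₗ B′.vector j)
          ≈⟨ ⊗-sumˡ {n = k} (λ i → α i M.*ₗ B.vector i) _ ⟩
        ∑ᵀ.sum (λ i → (α i M.*ₗ B.vector i) ⊗ᵛ ∑ᴺ.sum (λ j → β j N.*ₗ B′.vector j))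
          ≈⟨ ∑ᵀ.sum-cong-≋ {k} (λ i → ⊗-sumʳ {n = l} _ (λ j → β j N.*ₗ B′.vector j)) ⟩
        ∑ᵀ.sum (λ i → ∑ᵀ.sum (λ j →
          (α i M.*ₗ B.vector i) ⊗ᵛ (β j N.*ₗ B′.vector j)))
          ≈⟨ ∑ᵀ.sum-cong-≋ (λ i → ∑ᵀ.sum-cong-≋ (λ j → step i j)) ⟩
        ∑ᵀ.sum (λ i → ∑ᵀ.sum (λ j →
          coordᵗ (v ⊗ᵛ w) (combine i j) *ᵗ pure (i , j)))
          ≈⟨ lc₂ _ ⟨
        linearCombination (M ⊗ N) (coordᵗ (v ⊗ᵛ w)) vectorᵗ ∎
        where
        open SetoidReasoning T.≈ᴹ-setoid
        α = B.coord v
        β = B′.coord w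
        step : ∀ i j → (α i M.*ₗ B.vector i) ⊗ᵛ (β j N.*ₗ B′.vector j) T.≈ᴹ
                       coordᵗ (v ⊗ᵛ w) (combine i j) *ᵗ pure (i , j)
        step i j = transᵗ (⊗-*ˡ _ _ _) (transᵗ (*ᵗ-cong R.refl (⊗-*ʳ _ _ _))
          (transᵗ (symᵗ (*ᵗ-assoc _ _ _))
            (*ᵗ-cong (R.reflexive (≡.sym (≡.cong (λ (i , j) → α i R.* β j)
                                          (remQuot-combine i j)))) reflᵗ)))

      expandᵗ : ∀ u → u T.≈ᴹ linearCombination (M ⊗ N) (coordᵗ u) vectorᵗ
      expandᵗ (v ⊗ᵛ w) = expand-⊗ v w
      expandᵗ 0ᵗ       = ST.lc-0 vectorᵗ
      expandᵗ (u +ᵗ v) =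
        transᵗ (+ᵗ-cong (expandᵗ u) (expandᵗ v)) (ST.lc-+ vectorᵗ _ _)
      expandᵗ (c *ᵗ u) =
        transᵗ (*ᵗ-cong R.refl (expandᵗ u)) (ST.lc-* vectorᵗ c _)

      coord₂-lc : ∀ c i j →
        coord₂ (linearCombination (M ⊗ N) c vectorᵗ) i j R.≈ c (combine i j)
      coord₂-lc c i j = begin
        coord₂ (linearCombination (M ⊗ N) c vectorᵗ) i j
          ≈⟨ coord₂-cong (lc₂ c) i j ⟩
        coord₂ (∑ᵀ.sum (λ i′ → ∑ᵀ.sum (λ j′ →
          c (combine i′ j′) *ᵗ pure (i′ , j′)))) i j
          ≈⟨ R.trans (coord₂-sum {n = k} _ i j)
               (∑ᴿ.sum-cong-≋ {k} (λ i′ → coord₂-sum {n = l} (λ j′ →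
                 c (combine i′ j′) *ᵗ pure (i′ , j′)) i j)) ⟩
        ∑ᴿ.sum (λ i′ → ∑ᴿ.sum (λ j′ → c (combine i′ j′) R.*
          (B.coord (B.vector i′) i R.* B′.coord (B′.vector j′) j)))
          ≈⟨ ∑ᴿ.sum-cong-≋ inner ⟩
        ∑ᴿ.sum (λ i′ → B.coord (c (combine i′ j) M.*ₗ B.vector i′) i)
          ≈⟨ C.coord-sum {n = k} (λ i′ → c (combine i′ j) M.*ₗ B.vector i′) i ⟨
        B.coord (linearCombination M (λ i′ → c (combine i′ j)) B.vector) i
          ≈⟨ C.coord-lc _ i ⟩
        c (combine i j) ∎
        where
        open SetoidReasoning R.setoid
        inner : ∀ i′ → ∑ᴿ.sum (λ j′ → c (combine i′ j′) R.*
                  (B.coord (B.vector i′) i R.* B′.coord (B′.vector j′) j)) R.≈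
                B.coord (c (combine i′ j) M.*ₗ B.vector i′) i
        inner i′ = begin
          ∑ᴿ.sum (λ j′ → c (combine i′ j′) R.* (β R.* B′.coord (B′.vector j′) j))
            ≈⟨ ∑ᴿ.sum-cong-≋ swap ⟩
          ∑ᴿ.sum (λ j′ → B′.coord ((β R.* c (combine i′ j′)) N.*ₗ B′.vector j′) j)
            ≈⟨ C′.coord-sum {n = l}
                 (λ j′ → (β R.* c (combine i′ j′)) N.*ₗ B′.vector j′) j ⟨
          B′.coord (linearCombination N
            (λ j′ → β R.* c (combine i′ j′)) B′.vector) j
            ≈⟨ C′.coord-lc _ j ⟩
          β R.* c (combine i′ j)
            ≈⟨ R.*-comm _ _ ⟩
          c (combine i′ j) R.* β
            ≈⟨ C.coord-* _ _ i ⟨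
          B.coord (c (combine i′ j) M.*ₗ B.vector i′) i ∎
          where
          β = B.coord (B.vector i′) i
          swap : ∀ j′ →
            c (combine i′ j′) R.* (β R.* B′.coord (B′.vector j′) j) R.≈
            B′.coord ((β R.* c (combine i′ j′)) N.*ₗ B′.vector j′) j
          swap j′ = R.trans (R.sym (R.*-assoc _ _ _))
            (R.trans (R.*-congʳ (R.*-comm _ _)) (R.sym (C′.coord-* _ _ j)))

    infixl 7 _⊗ᴮ_

    -- Lexicographic: `combine i j` ↦ eᵢ ⊗ e′ⱼ.
    _⊗ᴮ_ : Basis (M ⊗ N) (k * l)
    _⊗ᴮ_ = record
      { vector = vectorᵗ
      ; coord  = coordᵗ
      ; expand = expandᵗ
      ; unique = λ u c eq h → R.trans
          (R.trans (coord₂-cong eq _ _) (coord₂-lc c _ _))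
          (R.reflexive (≡.cong c (combine-remQuot {k} l h)))
      }

  Endo : Module R m₁ ℓ₁ → Set m₁
  Endo M = Module.Carrierᴹ M → Module.Carrierᴹ M

  IsLinear : (M : Module R m₁ ℓ₁) → Endo M → Set (a ⊔ m₁ ⊔ ℓ₁)
  IsLinear M = ModuleMorphisms.IsModuleHomomorphism
    (Module.rawModule M) (Module.rawModule M)

  IsLinearAutomorphism : (M : Module R m₁ ℓ₁) → Endo M → Set (a ⊔ m₁ ⊔ ℓ₁)
  IsLinearAutomorphism M = ModuleMorphisms.IsModuleIsomorphism
    (Module.rawModule M) (Module.rawModule M)

  -- The basis b of V corresponds to X through the enumeration ξ of X.
  record IsLinearisation (S : Solution x) (ξ : Fin n ↔ Solution.X S)
                         {V : Module R m₁ ℓ₁} (b : Basis V n)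
                         (c : Endo (V ⊗ V)) : Set (x ⊔ a ⊔ ℓ ⊔ m₁ ⊔ ℓ₁) where
    open Solution S
    open Module (V ⊗ V) using (_≈ᴹ_)

    e : X → Module.Carrierᴹ V
    e u = Basis.vector b (Inverse.from ξ u)

    field
      linear   : IsLinear (V ⊗ V) c
      on-basis : ∀ u v → c (e u ⊗ᵛ e v) ≈ᴹ e (σ u v) ⊗ᵛ e (γ v u)

{-# OPTIONS --safe #-}

-- A linearisation permutes the basis, so an entry of its representing matrix is
-- a product of Kronecker deltas, one for σ and one for γ.  The delta of a pair
-- of indices is again a product, so an entry of e is a product of four deltas,
-- which regroup into an entry of c times an entry of d.
-- Since t is involutive, e is its own inverse.
module Submission where

open import Algebra.Bundles using (CommutativeRing)
open import Algebra.Module.Bundles using (Module)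
open import Algebra.Module.Morphism.Structures using (module ModuleMorphisms)
import Algebra.Properties.CommutativeMonoid.Sum as CommutativeMonoidSum
import Algebra.Properties.CommutativeSemigroup as CommutativeSemigroupProperties
open import Data.Fin.Base
  using (Fin; zero; suc; cast; combine; quotient; remainder; toℕ)
open import Data.Fin.Properties
  using (combine-surjective; remQuot-combine; toℕ-cast; toℕ-combine; toℕ-injective)
open import Data.Nat.Base using (ℕ; zero; suc; _+_; _*_)
open import Data.Nat.Properties using (*-assoc; *-comm; *-distribˡ-+; +-assoc)
open import Data.Product.Base using (_×_; _,_; proj₁; proj₂)
open import Data.Vec.Functional using (Vector)
open import Function.Base using (_∘_)
open import Function.Bundles using (_↔_; Inverse)
open import Level using (Level)
open import Relation.Binary.PropositionalEquality
  using (_≡_; refl; sym; trans; cong; cong₂; module ≡-Reasoning)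
import Relation.Binary.Reasoning.Setoid as SetoidReasoning
open import Defs

private
  variable
    x y m₁ ℓ₁ m₂ ℓ₂ : Level
    k n m : ℕ

-- Reassociation of lexicographic indices.

quotient-combine : ∀ (i : Fin n) (j : Fin k) → quotient {n} k (combine i j) ≡ i
quotient-combine i j = cong proj₁ (remQuot-combine i j)

remainder-combine : ∀ (i : Fin n) (j : Fin k) → remainder {n} k (combine i j) ≡ j
remainder-combine i j = cong proj₂ (remQuot-combine i j)

-- Both sides are the mixed-radix numeral with digits `p`, `q`, `r`, so their values under `toℕ`
-- agree; `cast` only changes the type of the bound.
combine-assoc : ∀ (p : Fin n) (q : Fin m) (r : Fin k) →
                cast (*-assoc n m k) (combine (combine p q) r) ≡
                combine p (combine q r)
combine-assoc {n} {m} {k} p q r = toℕ-injective (begin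
  toℕ (cast (*-assoc n m k) (combine (combine p q) r))
    ≡⟨ toℕ-cast (*-assoc n m k) (combine (combine p q) r) ⟩
  toℕ (combine (combine p q) r)             ≡⟨ toℕ-combine (combine p q) r ⟩
  k * toℕ (combine p q) + toℕ r
    ≡⟨ cong (λ h → k * h + toℕ r) (toℕ-combine p q) ⟩
  k * (m * toℕ p + toℕ q) + toℕ r
    ≡⟨ cong (_+ toℕ r) (*-distribˡ-+ k (m * toℕ p) (toℕ q)) ⟩
  k * (m * toℕ p) + k * toℕ q + toℕ r       ≡⟨ +-assoc (k * (m * toℕ p)) _ _ ⟩
  k * (m * toℕ p) + (k * toℕ q + toℕ r)
    ≡⟨ cong₂ _+_ km≡mk (toℕ-combine q r) ⟨
  m * k * toℕ p + toℕ (combine q r)         ≡⟨ toℕ-combine p (combine q r) ⟨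
  toℕ (combine p (combine q r))             ∎)
  where
  open ≡-Reasoning
  km≡mk : m * k * toℕ p ≡ k * (m * toℕ p)
  km≡mk = trans (cong (_* toℕ p) (*-comm m k)) (*-assoc k m (toℕ p))

module _ {n m k : ℕ} where

  -- Indices of Z ⊗ Z are grouped as `(n * m) * k`, those of a flattened Tracy-Singh product as
  -- `n * (m * k)`, with `k` equal to `n * m`. This lemma and `remainder-cast` translate the digits.
  quotient-cast : ∀ i → quotient {n} (m * k) (cast (*-assoc n m k) i) ≡
                        quotient {n} m (quotient {n * m} k i)
  quotient-cast i
    -- Every index is `combine (combine p q) r`, a form on which `combine-assoc` evaluates the cast.
    with h , r , refl ← combine-surjective {n * m} {k} i
    with p , q , refl ← combine-surjective {n} {m} h
    rewrite combine-assoc p q r | quotient-combine (combine p q) r =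
    trans (quotient-combine p (combine q r)) (sym (quotient-combine p q))

  remainder-cast : ∀ i → remainder {n} (m * k) (cast (*-assoc n m k) i) ≡
                         combine (remainder {n} m (quotient {n * m} k i))
                                 (remainder {n * m} k i)
  remainder-cast i
    with h , r , refl ← combine-surjective {n * m} {k} i
    with p , q , refl ← combine-surjective {n} {m} h
    rewrite combine-assoc p q r | quotient-combine (combine p q) r
          | remainder-combine (combine p q) r | remainder-combine p q =
    remainder-combine p (combine q r)

-- The product map acts componentwise, so its square is the pair of the two squares.
directProduct-involutive : (S : Solution x) (T : Solution y) →
                           Involutive S → Involutive T →
                           Involutive (directProduct S T)
directProduct-involutive S T invS invT ((u , a) , (v , b)) =
  cong₂ (λ (u , v) (a , b) → (u , a) , (v , b)) (invS (u , v)) (invT (a , b))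

-- Kronecker deltas and linear involutions.

module _ {a ℓ} (R : CommutativeRing a ℓ) where
  open LinearAlgebra R
  private
    module R = CommutativeRing R

  -- Recursion on the indices matches the recursion of `sum`, so that `lc-δ` can peel off one
  -- summand at a time.
  δ : Fin k → Fin k → R.Carrier
  δ zero    zero    = R.1#
  δ zero    (suc j) = R.0#
  δ (suc i) zero    = R.0#
  δ (suc i) (suc j) = δ i j

  module _ (M : Module R m₁ ℓ₁) where
    open Module M
    open SetoidReasoning ≈ᴹ-setoid

    lc-δ : (v : Vector Carrierᴹ k) (j : Fin k) →
           linearCombination M (λ i → δ i j) v ≈ᴹ v j
    lc-δ v zero = begin
      R.1# *ₗ v zero +ᴹ linearCombination M (λ _ → R.0#) (v ∘ suc)
        ≈⟨ +ᴹ-cong (*ₗ-identityˡ _) (≈ᴹ-sym (Sums.lc-0 M (v ∘ suc))) ⟩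
      v zero +ᴹ 0ᴹ ≈⟨ +ᴹ-identityʳ _ ⟩
      v zero       ∎
    lc-δ v (suc j) = begin
      R.0# *ₗ v zero +ᴹ linearCombination M (λ i → δ i j) (v ∘ suc)
        ≈⟨ +ᴹ-cong (*ₗ-zeroˡ _) (lc-δ (v ∘ suc) j) ⟩
      0ᴹ +ᴹ v (suc j) ≈⟨ +ᴹ-identityˡ _ ⟩
      v (suc j)       ∎

    module _ {f : Endo M} (linear : IsLinear M f) where
      open ModuleMorphisms.IsModuleHomomorphism linear

      linear-lc : ∀ (c : Vector R.Carrier k) v →
                  f (linearCombination M c v) ≈ᴹ linearCombination M c (f ∘ v)
      linear-lc {zero}  c v = 0ᴹ-homo
      linear-lc {suc k} c v = begin
        f (c zero *ₗ v zero +ᴹ linearCombination M (c ∘ suc) (v ∘ suc))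
          ≈⟨ +ᴹ-homo _ _ ⟩
        f (c zero *ₗ v zero) +ᴹ f (linearCombination M (c ∘ suc) (v ∘ suc))
          ≈⟨ +ᴹ-cong (*ₗ-homo _ _) (linear-lc (c ∘ suc) (v ∘ suc)) ⟩
        linearCombination M c (f ∘ v) ∎

      module _ (b : Basis M k) where
        open Basis b
        open CommutativeMonoidSum +ᴹ-commutativeMonoid using (sum-cong-≋)

        involutive-on-basis⇒involutive :
          (∀ j → f (f (vector j)) ≈ᴹ vector j) → ∀ v → f (f v) ≈ᴹ v
        involutive-on-basis⇒involutive ff≈id v = begin
          f (f v)
            ≈⟨ ⟦⟧-cong (⟦⟧-cong (expand v)) ⟩
          f (f (linearCombination M (coord v) vector))
            ≈⟨ ⟦⟧-cong (linear-lc (coord v) vector) ⟩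
          f (linearCombination M (coord v) (f ∘ vector))
            ≈⟨ linear-lc (coord v) (f ∘ vector) ⟩
          linearCombination M (coord v) (f ∘ f ∘ vector)
            ≈⟨ sum-cong-≋ (λ j → *ₗ-congˡ (ff≈id j)) ⟩
          linearCombination M (coord v) vector
            ≈⟨ expand v ⟨
          v ∎

      -- Applying `f` once more cancels it, which gives injectivity, and `f w` is a preimage of `w`.
      linear-involution⇒automorphism :
        (∀ v → f (f v) ≈ᴹ v) → IsLinearAutomorphism M f
      linear-involution⇒automorphism ff≈id = record
        { isModuleMonomorphism = record
          { isModuleHomomorphism = linear
          ; injective = λ {v} {w} eq →
              ≈ᴹ-trans (≈ᴹ-sym (ff≈id v)) (≈ᴹ-trans (⟦⟧-cong eq) (ff≈id w))
          }
        ; surjective = λ w → f w , λ eq → ≈ᴹ-trans (⟦⟧-cong eq) (ff≈id w)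
        }

  -- By `lc-δ` the deltas are coefficients of the basis vector, and coefficients are unique.
  coord-vector : {M : Module R m₁ ℓ₁} (b : Basis M k) → ∀ i j →
                 Basis.coord b (Basis.vector b j) i R.≈ δ i j
  coord-vector {M = M} b i j =
    Basis.unique b _ (λ h → δ h j)
      (Module.≈ᴹ-sym M (lc-δ M (Basis.vector b) j)) i

  -- Both sides are the coordinate of the j-th vector of b ⊗ᴮ b′ at i.
  δ-remQuot : {M : Module R m₁ ℓ₁} {N : Module R m₂ ℓ₂} →
              Basis M n → Basis N m → ∀ i j →
              δ i j R.≈ δ (quotient {n} m i) (quotient {n} m j) R.*
                        δ (remainder {n} m i) (remainder {n} m j)
  δ-remQuot b b′ i j = R.trans (R.sym (coord-vector (b ⊗ᴮ b′) i j))
    (R.*-cong (coord-vector b _ _) (coord-vector b′ _ _))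

  -- The matrix and the square of a linearisation.

  module _ {S : Solution x} {ξ : Fin n ↔ Solution.X S}
           {V : Module R m₁ ℓ₁} {b : Basis V n} {c : Endo (V ⊗ V)}
           (lin : IsLinearisation S ξ b c) where
    open Solution S
    open Inverse ξ using (to; from; strictlyInverseʳ)
    open IsLinearisation lin
    open Module (V ⊗ V) using (_≈ᴹ_; ≈ᴹ-trans; ≈ᴹ-reflexive; ≈ᴹ-setoid)
    open ModuleMorphisms.IsModuleHomomorphism linear using (⟦⟧-cong)
    open Basis (b ⊗ᴮ b) using (vector)

    private
      fst snd : Fin (n * n) → X
      fst j = to (quotient {n} n j)
      snd j = to (remainder {n} n j)

    -- Bridges the numbering of the basis and `on-basis`, which is indexed by elements of `X`.
    vector≡e⊗e : ∀ j → vector j ≡ e (fst j) ⊗ᵛ e (snd j)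
    vector≡e⊗e j = sym (cong₂ (λ p q → Basis.vector b p ⊗ᵛ Basis.vector b q)
      (strictlyInverseʳ _) (strictlyInverseʳ _))

    linearisation-vector : ∀ j →
      c (vector j) ≈ᴹ e (σ (fst j) (snd j)) ⊗ᵛ e (γ (snd j) (fst j))
    linearisation-vector j =
      ≈ᴹ-trans (⟦⟧-cong (≈ᴹ-reflexive (vector≡e⊗e j))) (on-basis _ _)

    -- The image of a basis vector is a pure tensor of basis vectors, and the coordinate of a pure
    -- tensor is by definition a product.
    linearisation-entry : ∀ i j → representingMatrix (b ⊗ᴮ b) c i j R.≈
      δ (quotient {n} n i) (from (σ (fst j) (snd j))) R.*
      δ (remainder {n} n i) (from (γ (snd j) (fst j)))
    linearisation-entry i j = R.trans
      (Coordinates.coord-cong (b ⊗ᴮ b) (linearisation-vector j) i)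
      (R.*-cong (coord-vector b _ _) (coord-vector b _ _))

    -- The form that `partition` produces: `p` and `p′` select the block, `r` and `r′` the entry
    -- inside it.
    linearisation-entry-combine : ∀ p r p′ r′ →
      representingMatrix (b ⊗ᴮ b) c (combine p r) (combine p′ r′) R.≈
      δ p (from (σ (to p′) (to r′))) R.* δ r (from (γ (to r′) (to p′)))
    linearisation-entry-combine p r p′ r′
      with linearisation-entry (combine p r) (combine p′ r′)
    ... | eq rewrite quotient-combine p r | remainder-combine p r
                   | quotient-combine p′ r′ | remainder-combine p′ r′ = eq

    linearisation-involutive : Involutive S → ∀ v → c (c v) ≈ᴹ v
    linearisation-involutive inv =
      involutive-on-basis⇒involutive (V ⊗ V) linear (b ⊗ᴮ b) λ j → begin
        c (c (vector j))
          ≈⟨ ⟦⟧-cong (linearisation-vector j) ⟩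
        c (e (σ (fst j) (snd j)) ⊗ᵛ e (γ (snd j) (fst j)))
          ≈⟨ on-basis _ _ ⟩
        -- After two uses of `on-basis` the tensor is indexed by `r (r (fst j , snd j))`.
        _ ≡⟨ cong (λ (u , v) → e u ⊗ᵛ e v) (inv (fst j , snd j)) ⟩
        e (fst j) ⊗ᵛ e (snd j)
          ≡⟨ vector≡e⊗e j ⟨
        vector j ∎
      where open SetoidReasoning ≈ᴹ-setoid

    linearisation-automorphism : Involutive S → IsLinearAutomorphism (V ⊗ V) c
    linearisation-automorphism inv =
      linear-involution⇒automorphism (V ⊗ V) linear (linearisation-involutive inv)

-- Comparison of the matrix of the direct product with the Tracy-Singh product.

theorem1 :
    ∀ {a ℓ x y v ℓv v′ ℓv′ w ℓw}
    (R : CommutativeRing a ℓ) →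
    let open LinearAlgebra R in
    (S : Solution x) → NonDegenerate S → Involutive S →
    (T : Solution y) → NonDegenerate T → Involutive T →
    (n m : ℕ) (ξ : Fin n ↔ Solution.X S) (υ : Fin m ↔ Solution.X T) →
    (V : Module R v ℓv) (b : Basis V n)
    (V′ : Module R v′ ℓv′) (b′ : Basis V′ m)
    (W : Module R w ℓw) (b″ : Basis W (n * m)) →
    (c : Endo (V ⊗ V)) → IsLinearisation S ξ b c →
    (d : Endo (V′ ⊗ V′)) → IsLinearisation T υ b′ d →
    (e : Endo (W ⊗ W)) → IsLinearisation (directProduct S T) (lexicographic ξ υ) b″ e →
    let C = partition n n (representingMatrix (b ⊗ᴮ b) c)
        D = partition m m (representingMatrix (b′ ⊗ᴮ b′) d)
    in
    IsLinearAutomorphism (W ⊗ W) e ×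
    (∀ i j → CommutativeRing._≈_ R
      (representingMatrix (b″ ⊗ᴮ b″) e i j)
      (flatten (C ⊠ D) (cast (*-assoc n m (n * m)) i) (cast (*-assoc n m (n * m)) j)))
theorem1 R S _ invS T _ invT n m ξ υ V b V′ b′ W b″ c linC d linD e linE =
  linearisation-automorphism R linE (directProduct-involutive S T invS invT) , entry
  where
  open LinearAlgebra R
  module R = CommutativeRing R
  module S = Solution S
  module T = Solution T
  open Inverse ξ using () renaming (to to toX; from to fromX)
  open Inverse υ using () renaming (to to toY; from to fromY)
  open CommutativeSemigroupProperties R.*-commutativeSemigroup using (interchange)
  open SetoidReasoning R.setoid

  C = partition n n (representingMatrix (b ⊗ᴮ b) c)
  D = partition m m (representingMatrix (b′ ⊗ᴮ b′) d)

  fstZ : Fin (n * m) → Fin n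
  fstZ = quotient {n} m

  sndZ : Fin (n * m) → Fin m
  sndZ = remainder {n} m

  δ-combine : ∀ h p q → δ R h (combine p q) R.≈ δ R (fstZ h) p R.* δ R (sndZ h) q
  -- `b` and `b′` provide the tensor basis through which the delta on `Fin (n * m)` factors.
  δ-combine h p q with δ-remQuot R b b′ h (combine p q)
  ... | eq rewrite quotient-combine p q | remainder-combine p q = eq

  -- Once reassociated, the X-digit of the first tensor factor selects the outer block and its
  -- Y-digit the inner one; the second factor locates the entry of the Kronecker product.
  block : ∀ i j → flatten (C ⊠ D) (cast (*-assoc n m (n * m)) i)
                                  (cast (*-assoc n m (n * m)) j) ≡
    (let z = quotient {n * m} (n * m) i ; z′ = remainder {n * m} (n * m) i
         w = quotient {n * m} (n * m) j ; w′ = remainder {n * m} (n * m) j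
     in C (fstZ z) (fstZ w) (fstZ z′) (fstZ w′) R.*
        D (sndZ z) (sndZ w) (sndZ z′) (sndZ w′))
  block i j
    rewrite quotient-cast {n} {m} {n * m} i | remainder-cast {n} {m} {n * m} i
          | quotient-cast {n} {m} {n * m} j | remainder-cast {n} {m} {n * m} j
          | quotient-combine (sndZ (quotient {n * m} (n * m) i)) (remainder {n * m} (n * m) i)
          | remainder-combine (sndZ (quotient {n * m} (n * m) i)) (remainder {n * m} (n * m) i)
          | quotient-combine (sndZ (quotient {n * m} (n * m) j)) (remainder {n * m} (n * m) j)
          | remainder-combine (sndZ (quotient {n * m} (n * m) j)) (remainder {n * m} (n * m) j)
    = refl

  entry : ∀ i j → representingMatrix (b″ ⊗ᴮ b″) e i j R.≈
    flatten (C ⊠ D) (cast (*-assoc n m (n * m)) i) (cast (*-assoc n m (n * m)) j)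
  entry i j = begin
    representingMatrix (b″ ⊗ᴮ b″) e i j
      -- `from` of `lexicographic` computes to `combine` of `fromX` and `fromY`, so the two
      -- components of the product map at `w`, `w′` have numbers `combine p q` and `combine p′ q′`.
      ≈⟨ linearisation-entry R linE i j ⟩
    δ R z (combine p q) R.* δ R z′ (combine p′ q′)
      ≈⟨ R.*-cong (δ-combine z p q) (δ-combine z′ p′ q′) ⟩
    (δ R (fstZ z) p R.* δ R (sndZ z) q) R.* (δ R (fstZ z′) p′ R.* δ R (sndZ z′) q′)
      -- Exchanging the middle factors gathers the two X-deltas, an entry of `c`, and the two
      -- Y-deltas, an entry of `d`.
      ≈⟨ interchange _ _ _ _ ⟩
    (δ R (fstZ z) p R.* δ R (fstZ z′) p′) R.* (δ R (sndZ z) q R.* δ R (sndZ z′) q′)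
      ≈⟨ R.*-cong (linearisation-entry-combine R linC _ _ _ _)
                  (linearisation-entry-combine R linD _ _ _ _) ⟨
    C (fstZ z) (fstZ w) (fstZ z′) (fstZ w′) R.* D (sndZ z) (sndZ w) (sndZ z′) (sndZ w′)
      ≡⟨ block i j ⟨
    flatten (C ⊠ D) (cast (*-assoc n m (n * m)) i) (cast (*-assoc n m (n * m)) j) ∎
    where
    z z′ w w′ : Fin (n * m)
    z  = quotient {n * m} (n * m) i
    z′ = remainder {n * m} (n * m) i
    w  = quotient {n * m} (n * m) j
    w′ = remainder {n * m} (n * m) j

    p p′ : Fin n
    p  = fromX (S.σ (toX (fstZ w)) (toX (fstZ w′)))
    p′ = fromX (S.γ (toX (fstZ w′)) (toX (fstZ w)))

    q q′ : Fin m
    q  = fromY (T.σ (toY (sndZ w)) (toY (sndZ w′)))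
    q′ = fromY (T.γ (toY (sndZ w′)) (toY (sndZ w)))
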